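{- Let $B_1$ be a finite simple graph with $2n$ vertices and $q$ edges, where $q$ is even and $\frac{q}{2}=n$. Suppose that $B_1$ has $n$ mutually disjoint $\langle xyz\rangle$ paths such that no cycle of $B_1$ contains an odd number of these paths, and that $B_1$ has a set of $n$ pairwise nonadjacent edges such that each of these edges is in exactly one of the $n$ $\langle xyz\rangle$ paths. Then both $B_1$ and its line graph $L(B_1)$ are 2-variegated graphs; that is, $B_1$ is a solution of the equation $L(B_1)=B_2$ with $B_1$ and $B_2$ both 2-variegated.
   Context: All graphs are finite, without loops or multiple edges. A graph $B$ with $2m$ vertices is 2-variegated (bivariegated) if its vertex set can be partitioned into two parts of equal size $m$ such that each vertex of either part is adjacent to exactly one vertex of the other part (adjacencies inside a part are unrestricted). The line graph $L(G)$ has the edges of $G$ as vertices, two of them being adjacent in $L(G)$ if and only if the corresponding edges of $G$ share an endpoint. An $\langle xyz\rangle$ path in $G$ is a path of length 2 with edges $xy$ and $yz$ on three distinct vertices $x,y,z$ that is an induced subgraph of $G$ (so $x$ and $z$ are not adjacent in $G$) and whose middle vertex $y$ has degree exactly $2$ in $G$. Two paths are disjoint if they have no common edge. Edges are nonadjacent if they share no endpoint. A cycle contains an $\langle xyz\rangle$ path if both edges of the path are edges of the cycle. -}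

module Defs where

open import Level using (0ℓ)
open import Data.Nat using (ℕ; _*_; _≤_)
open import Data.Fin using (Fin; _≟_; _<?_)
open import Data.Fin.Properties using (any?; all?)
open import Data.Fin.Subset using (Subset; _∈_; ∁; ∣_∣)
open import Data.List using (List; []; _∷_; _∷ʳ_; length; filter; allFin; cartesianProduct; lookup)
open import Data.List.Relation.Unary.All using (All)
open import Data.List.Relation.Unary.Unique.Propositional using (Unique)
import Data.List.Membership.Propositional as List
import Data.List.Membership.DecPropositional as DecList
open import Data.Product using (∃-syntax; ∃!; _×_; _,_; proj₁; proj₂; swap; uncurry)
open import Data.Product.Properties using (≡-dec)
open import Data.Sum using (_⊎_)
open import Function using (_∘_)
open import Relation.Binary using (Rel; Symmetric; Irreflexive; Decidable)
open import Relation.Binary.PropositionalEquality using (_≡_; _≢_; sym)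
open import Relation.Nullary using (¬_; ¬?)
open import Relation.Nullary.Decidable using (_×-dec_; _⊎-dec_; _→-dec_)

record Graph (N : ℕ) : Set₁ where
  infix 4 _~_ _~?_
  field
    _~_      : Rel (Fin N) 0ℓ
    _~?_     : Decidable _~_
    ~-sym    : Symmetric _~_
    ~-irrefl : Irreflexive _≡_ _~_

  Vertex : Set
  Vertex = Fin N

  degree : Vertex → ℕ
  degree v = length (filter (v ~?_) (allFin N))

  -- Each edge is listed once, with its smaller endpoint first.
  edges : List (Vertex × Vertex)
  edges = filter (λ (u , v) → (u <? v) ×-dec (u ~? v))
                 (cartesianProduct (allFin N) (allFin N))

  size : ℕ
  size = length edges

  -- An edge is its position in the list `edges`.
  Edge : Set
  Edge = Fin size

  endpoints : Edge → Vertex × Vertex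
  endpoints = lookup edges

  Incident : Vertex → Edge → Set
  Incident v e = v ≡ proj₁ (endpoints e) ⊎ v ≡ proj₂ (endpoints e)

  Incident? : Decidable Incident
  Incident? v e = (v ≟ proj₁ (endpoints e)) ⊎-dec (v ≟ proj₂ (endpoints e))

  ShareEndpoint : Rel Edge 0ℓ
  ShareEndpoint e f = ∃[ v ] (Incident v e × Incident v f)

  ShareEndpoint? : Decidable ShareEndpoint
  ShareEndpoint? e f = any? λ v → Incident? v e ×-dec Incident? v f

  steps : List Vertex → List (Vertex × Vertex)
  steps []           = []
  steps (u ∷ [])     = []
  steps (u ∷ v ∷ vs) = (u , v) ∷ steps (v ∷ vs)

  -- The edge e joins two consecutive vertices of the sequence, in either order.
  _On_ : Edge → List Vertex → Set
  e On vs = endpoints e List.∈ steps vs ⊎ swap (endpoints e) List.∈ steps vs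

  _On?_ : Decidable _On_
  e On? vs = (endpoints e ∈? steps vs) ⊎-dec (swap (endpoints e) ∈? steps vs)
    where open DecList (≡-dec _≟_ _≟_) using (_∈?_)

  record XYZPath : Set where
    field
      x y z    : Vertex
      x≢y      : x ≢ y
      y≢z      : y ≢ z
      x≢z      : x ≢ z
      x~y      : x ~ y
      y~z      : y ~ z
      x≁z      : ¬ (x ~ z)
      degree-y : degree y ≡ 2

    vertices : List Vertex
    vertices = x ∷ y ∷ z ∷ []

  record Cycle : Set where
    field
      base     : Vertex
      rest     : List Vertex
      distinct : Unique (base ∷ rest)
      long     : 3 ≤ length (base ∷ rest)

    closedWalk : List Vertex
    closedWalk = base ∷ rest ∷ʳ base

    field
      adjacent : All (uncurry _~_) (steps closedWalk)

  EdgeDisjoint : Rel XYZPath 0ℓ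
  EdgeDisjoint p p′ = ¬ (∃[ e ] (e On XYZPath.vertices p × e On XYZPath.vertices p′))

  Contains : Cycle → XYZPath → Set
  Contains c p = ∀ e → e On XYZPath.vertices p → e On Cycle.closedWalk c

  Contains? : Decidable Contains
  Contains? c p = all? λ e → (e On? XYZPath.vertices p) →-dec (e On? Cycle.closedWalk c)

  countContained : ∀ {k} → Cycle → (Fin k → XYZPath) → ℕ
  countContained {k} c paths = length (filter (λ i → Contains? c (paths i)) (allFin k))

  PairwiseNonadjacent : Subset size → Set
  PairwiseNonadjacent M = ∀ {e f} → e ∈ M → f ∈ M → e ≢ f → ¬ ShareEndpoint e f

LineGraph : ∀ {N} (G : Graph N) → Graph (Graph.size G)
LineGraph G = record
  { _~_      = λ e f → e ≢ f × ShareEndpoint e f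
  ; _~?_     = λ e f → ¬? (e ≟ f) ×-dec ShareEndpoint? e f
  ; ~-sym    = λ (e≢f , v , ve , vf) → (e≢f ∘ sym) , v , vf , ve
  ; ~-irrefl = λ e≡f (e≢f , _) → e≢f e≡f
  }
  where open Graph G

TwoVariegated : ∀ {N} → Graph N → Set
TwoVariegated {N} G =
  ∃[ m ] (N ≡ 2 * m ×
    ∃[ P ] (∣ P ∣ ≡ m × ∣ ∁ P ∣ ≡ m ×
      (∀ v → v ∈ P → ∃! _≡_ λ w → w ∈ ∁ P × v ~ w) ×
      (∀ v → v ∈ ∁ P → ∃! _≡_ λ w → w ∈ P × v ~ w)))
  where open Graph G using (_~_)

{-# OPTIONS --safe #-}
module Submission where

-- The n disjoint ⟨xyz⟩ paths use up all 2n edges, and each of them carries exactly one of the n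
-- nonadjacent edges. Let Y i be the middle of path i, X i the other end of its marked edge and Z i
-- its remaining vertex. The marked edges form a perfect matching, so the X i and Y i are all the
-- vertices. Since Y i has degree 2, no Z i is a middle vertex, hence Z i = X (next i): the graph is
-- the subdivision of the functional graph of `next`. A simple closed orbit of `next` of length k
-- is a cycle containing exactly k of the paths, so all closed orbits are even and `next` admits a
-- 2-colouring g with g (next i) ≠ g i. Colouring X i by g i and Y i by its opposite makes the
-- marked edges the only bichromatic ones; colouring each edge like its end of the form X j makes
-- the two edges of each path the only adjacent edges of different colours.

open import Defs
open import Data.Bool using (Bool; true; false; not)
open import Data.Bool.Properties using (¬-not; not-¬; not-involutive)
open import Data.Empty using (⊥-elim)
open import Data.Fin as Fin using (Fin; zero; suc; toℕ; fromℕ<; splitAt; join)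
open import Data.Fin.Permutation using (Permutation′; permutation)
open import Data.Fin.Properties as Fin using (any?; pigeonhole; punchOut-injective; join-splitAt; <⇒notInjective; toℕ-fromℕ<; toℕ<n)
open import Data.Fin.Subset using (Subset; _∈_; ∁; ∣_∣)
open import Data.Fin.Subset.Properties using (∣p∣≤n; ∣∁p∣≡n∸∣p∣; x∉p⇒x∈∁p; x∈∁p⇒x∉p)
open import Data.List as List using (List; []; _∷_; _∷ʳ_; length; filter; allFin; cartesianProduct)
open import Data.List.Properties using (length-iterate)
import Data.List.Membership.DecPropositional as DecMembership
open import Data.List.Membership.Propositional using () renaming (_∈_ to _∈ₗ_)
open import Data.List.Membership.Propositional.Properties using (∈-lookup; ∈-filter⁺; ∈-filter⁻; ∈-cartesianProduct⁺; ∈-allFin; ∈-++⁻)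
open import Data.List.Membership.Propositional.Properties.WithK using (unique∧set⇒bag)
open import Data.List.Relation.Binary.BagAndSetEquality using (∼bag⇒↭)
open import Data.List.Relation.Binary.Permutation.Propositional.Properties using (↭-length)
open import Data.List.Relation.Unary.All as All using (All; []; _∷_)
open import Data.List.Relation.Unary.All.Properties using (¬Any⇒All¬; All¬⇒¬Any)
open import Data.List.Relation.Unary.AllPairs using ([]; _∷_)
open import Data.List.Relation.Unary.Any using (here; there; index)
open import Data.List.Relation.Unary.Any.Properties using (lookup-index)
open import Data.List.Relation.Unary.Unique.Propositional using (Unique)
open import Data.List.Relation.Unary.Unique.Propositional.Properties using (filter⁺; cartesianProduct⁺; allFin⁺)
open import Data.Nat using (ℕ; zero; suc; _+_; _*_; _∸_; _/_; _%_; _<_; s≤s; z≤n)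
open import Data.Nat.Base using (parity)
open import Data.Nat.DivMod using (m/n*n≡m)
open import Data.Nat.Divisibility using (_∣_)
open import Data.Nat.GeneralisedArithmetic using (iterate)
open import Data.Nat.Induction using (<-wellFounded)
open import Data.Nat.Properties as ℕ using (+-comm; m≤n+m; m+[n∸m]≡n; n<1+n; ≮⇒≥)
open import Data.Parity.Base as ℙ using (0ℙ; 1ℙ; _⁻¹)
open import Data.Parity.Properties as ℙ using (+-homo-+)
open import Data.Product using (∃; ∃₂; ∃!; ∃-syntax; _×_; _,_; proj₁; proj₂; swap; uncurry)
open import Data.Product.Properties using (,-injective)
open import Data.Sum as Sum using (_⊎_; inj₁; inj₂; [_,_]; [_,_]′; reduce)
open import Data.Sum.Properties using (swap-involutive; inj₁-injective; inj₂-injective)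
open import Data.Vec using ([]; _∷_; tabulate; here; there)
open import Data.Vec.Properties using (lookup∘tabulate; []=⇒lookup; lookup⇒[]=)
open import Function using (_∘_; case_of_; _↔_; mk↔ₛ′; Inverse; Injection; Injective; mk⇔)
open import Function.Properties.Inverse using (↔⇒↣)
open import Induction.WellFounded using (Acc; acc)
open import Relation.Binary using (DecidableEquality; tri<; tri≈; tri>)
open import Relation.Binary.PropositionalEquality hiding ([_])
open import Relation.Nullary using (¬_; Dec; yes; no; contradiction)
open import Relation.Nullary.Decidable using (does; map′)
open import Relation.Unary using (Pred; Decidable)
open import Algebra.Properties.CommutativeMonoid.Sum ℕ.+-0-commutativeMonoid using (sum; sum-permute; sum-cong-≗)

-- Functional graphs

module _ {a} {A : Set a} (f : A → A) where

  iterate-+ : ∀ x m n → iterate f x (m + n) ≡ iterate f (iterate f x m) n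
  iterate-+ x zero    n = refl
  iterate-+ x (suc m) n = iterate-+ (f x) m n

  iterate-comm : ∀ x m n → iterate f (iterate f x m) n ≡ iterate f (iterate f x n) m
  iterate-comm x m n =
    trans (sym (iterate-+ x m n)) (trans (cong (iterate f x) (+-comm m n)) (iterate-+ x n m))

  -- The bound on the position `p` is given by a remainder `r`, so that lengths of pieces of an
  -- orbit can be added without subtraction.
  ∈-iterate⁻ : ∀ {x y} k → y ∈ₗ List.iterate f x k →
               ∃₂ λ p r → p + suc r ≡ k × iterate f x p ≡ y
  ∈-iterate⁻ (suc k) (here refl) = 0 , k , refl , refl
  ∈-iterate⁻ (suc k) (there y∈) with p , r , p+r≡k , eq ← ∈-iterate⁻ k y∈ =
    suc p , r , cong suc p+r≡k , eq

  module _ (_≟_ : DecidableEquality A) where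

    open DecMembership _≟_ using (_∈?_)

    -- The three summands of `k` are the steps before the repeated element, the loop back to it, and
    -- the rest. The rest is positive because the list holds only the iterates with exponent below
    -- `k`.
    unique⊎repeats : ∀ x k → Unique (List.iterate f x k) ⊎
      (∃ λ p → ∃₂ λ l r → p + suc l + suc r ≡ k ×
         iterate f (iterate f x p) (suc l) ≡ iterate f x p)
    unique⊎repeats x zero = inj₁ []
    unique⊎repeats x (suc k) with x ∈? List.iterate f (f x) k | unique⊎repeats (f x) k
    ... | yes x∈ | _ with l , r , l+r≡k , eq ← ∈-iterate⁻ k x∈ =
      inj₂ (0 , l , r , cong suc l+r≡k , eq)
    ... | no x∉ | inj₁ u = inj₁ (¬Any⇒All¬ _ x∉ ∷ u)
    ... | no x∉ | inj₂ (p , l , r , sum≡k , eq) = inj₂ (suc p , l , r , cong suc sum≡k , eq)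

    -- A repetition splits a closed orbit into two shorter ones, one of which is odd.
    simple-odd-orbit : ∀ x k → iterate f x k ≡ x → parity k ≡ 1ℙ →
      ∃₂ λ y d → iterate f y d ≡ y × parity d ≡ 1ℙ × Unique (List.iterate f y d)
    simple-odd-orbit x k = go x k (<-wellFounded k)
      where
      go : ∀ x k → Acc _<_ k → iterate f x k ≡ x → parity k ≡ 1ℙ →
        ∃₂ λ y d → iterate f y d ≡ y × parity d ≡ 1ℙ × Unique (List.iterate f y d)
      go x k (acc rec) closed odd with unique⊎repeats x k
      ... | inj₁ u = x , k , closed , odd , u
      ... | inj₂ (p , l , r , refl , eq) with parity (suc l) in parity-l
      ...   | 1ℙ = go (iterate f x p) (suc l)
        (rec (ℕ.≤-<-trans (m≤n+m (suc l) p) (ℕ.m<m+n _ (s≤s z≤n)))) eq parity-l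
      -- An even loop is cut out of the orbit, which shortens it and keeps its length odd.
      ...   | 0ℙ = go x (p + suc r)
        (rec (ℕ.+-monoˡ-< (suc r) (ℕ.m<m+n p (s≤s z≤n))))
        (begin
          iterate f x (p + suc r)                             ≡⟨ iterate-+ x p (suc r) ⟩
          iterate f (iterate f x p) (suc r)                   ≡⟨ cong (λ y → iterate f y (suc r)) eq ⟨
          iterate f (iterate f (iterate f x p) (suc l)) (suc r)
            ≡⟨ cong (λ y → iterate f y (suc r)) (iterate-+ x p (suc l)) ⟨
          iterate f (iterate f x (p + suc l)) (suc r)         ≡⟨ iterate-+ x (p + suc l) (suc r) ⟨
          iterate f x (p + suc l + suc r)                     ≡⟨ closed ⟩
          x                                                   ∎)
        (begin
          parity (p + suc r)                          ≡⟨ +-homo-+ p (suc r) ⟩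
          parity p ℙ.+ parity (suc r)                 ≡⟨ cong (ℙ._+ parity (suc r)) (ℙ.+-identityʳ (parity p)) ⟨
          parity p ℙ.+ 0ℙ ℙ.+ parity (suc r)          ≡⟨ cong (λ s → parity p ℙ.+ s ℙ.+ parity (suc r)) parity-l ⟨
          parity p ℙ.+ parity (suc l) ℙ.+ parity (suc r) ≡⟨ cong (ℙ._+ parity (suc r)) (+-homo-+ p (suc l)) ⟨
          parity (p + suc l) ℙ.+ parity (suc r)       ≡⟨ +-homo-+ (p + suc l) (suc r) ⟨
          parity (p + suc l + suc r)                  ≡⟨ odd ⟩
          1ℙ                                          ∎)
        where open ≡-Reasoning

least : ∀ {n p} {P : Pred (Fin n) p} → Decidable P → ∃ P → ∃ λ i → P i × ∀ j → P j → i Fin.≤ j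
least {suc n} P? (i , pi) with P? Fin.zero
... | yes p₀ = Fin.zero , p₀ , λ _ _ → z≤n
least {suc n} P? (Fin.zero , pi) | no ¬p₀ = ⊥-elim (¬p₀ pi)
least {suc n} P? (Fin.suc i , pi) | no ¬p₀ with k , pk , min ← least (P? ∘ Fin.suc) (i , pi) =
  Fin.suc k , pk , λ { Fin.zero p₀ → ⊥-elim (¬p₀ p₀) ; (Fin.suc j) pj → s≤s (min j pj) }

-- Two-colourings of finite functional graphs without odd closed orbits.

module _ {n : ℕ} (f : Fin n → Fin n) where

  -- For `k` at least `n`, two of the iterates with exponents from 0 to `n` coincide. Cutting out
  -- the steps between them gives a smaller exponent with the same result.
  iterate-bounded : ∀ i k → ∃ λ (l : Fin n) → iterate f i (toℕ l) ≡ iterate f i k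
  iterate-bounded i k = go k (<-wellFounded k)
    where
    open ≡-Reasoning
    q+[k∸q]≡k : ∀ {k} → ¬ (k < n) → (q : Fin (suc n)) → toℕ q + (k ∸ toℕ q) ≡ k
    q+[k∸q]≡k k≮n q = m+[n∸m]≡n (ℕ.≤-trans (ℕ.≤-pred (toℕ<n q)) (≮⇒≥ k≮n))
    go : ∀ k → Acc _<_ k → ∃ λ (l : Fin n) → iterate f i (toℕ l) ≡ iterate f i k
    go k (acc rec) with k ℕ.<? n
    ... | yes k<n = fromℕ< k<n , cong (iterate f i) (toℕ-fromℕ< k<n)
    ... | no k≮n with p , q , p<q , same ← pigeonhole (n<1+n n) (iterate f i ∘ toℕ)
      with l , eq ← go (toℕ p + (k ∸ toℕ q))
                       (rec (subst (toℕ p + (k ∸ toℕ q) <_) (q+[k∸q]≡k k≮n q)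
                                   (ℕ.+-monoˡ-< (k ∸ toℕ q) p<q))) = l , (begin
        iterate f i (toℕ l)                               ≡⟨ eq ⟩
        iterate f i (toℕ p + (k ∸ toℕ q))                 ≡⟨ iterate-+ f i (toℕ p) _ ⟩
        iterate f (iterate f i (toℕ p)) (k ∸ toℕ q)       ≡⟨ cong (λ j → iterate f j (k ∸ toℕ q)) same ⟩
        iterate f (iterate f i (toℕ q)) (k ∸ toℕ q)       ≡⟨ iterate-+ f i (toℕ q) _ ⟨
        iterate f i (toℕ q + (k ∸ toℕ q))                 ≡⟨ cong (iterate f i) (q+[k∸q]≡k k≮n q) ⟩
        iterate f i k                                     ∎)

  -- In the functional graph of `f` this says that `i` and `j` lie in the same weak component.
  Meet : Fin n → Fin n → Set
  Meet i j = ∃₂ λ a b → iterate f i a ≡ iterate f j b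

  -- By `iterate-bounded` exponents below `n` suffice, which leaves a finite search.
  meet? : ∀ i → Decidable (Meet i)
  meet? i j = map′ (λ (a , b , eq) → toℕ a , toℕ b , eq) bounded
    (any? λ a → any? λ b → iterate f i (toℕ a) Fin.≟ iterate f j (toℕ b))
    where
    bounded : Meet i j → ∃₂ λ (a b : Fin n) → iterate f i (toℕ a) ≡ iterate f j (toℕ b)
    bounded (a , b , eq) with a′ , eqa ← iterate-bounded i a | b′ , eqb ← iterate-bounded j b =
      a′ , b′ , trans eqa (trans eq (sym eqb))

  meet-step⁺ : ∀ {i j} → Meet i j → Meet (f i) j
  meet-step⁺ {i} {j} (a , b , eq) = a , suc b , (begin
    iterate f (f i) a         ≡⟨ iterate-comm f i 1 a ⟩
    iterate f (iterate f i a) 1 ≡⟨ cong f eq ⟩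
    iterate f (iterate f j b) 1 ≡⟨ iterate-comm f j 1 b ⟨
    iterate f j (suc b)       ∎)
    where open ≡-Reasoning

  meet-step⁻ : ∀ {i j} → Meet (f i) j → Meet i j
  meet-step⁻ (a , b , eq) = suc a , b , eq

  -- The least element of a component serves as its canonical representative.
  root : ∀ i → ∃ λ r → Meet i r × ∀ j → Meet i j → r Fin.≤ j
  root i = least (meet? i) (i , 0 , 0 , refl)

  -- `i` and `f i` meet the same elements, so each of the two minima bounds the other.
  root-step : ∀ i → proj₁ (root i) ≡ proj₁ (root (f i))
  root-step i with r , m , min ← root i | r′ , m′ , min′ ← root (f i) =
    Fin.≤-antisym (min r′ (meet-step⁻ m′)) (min′ r (meet-step⁺ m))

  module _ (no-odd-orbit : ∀ i k → parity k ≡ 1ℙ → iterate f i k ≢ i) where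

    -- The `k`-th iterate starts a closed orbit of length `l ∸ k`, which cannot be odd.
    iterate-<⇒parity : ∀ i {k l} → k < l → iterate f i k ≡ iterate f i l → parity k ≡ parity l
    iterate-<⇒parity i {k} {l} k<l eq = even-difference (parity (l ∸ k)) refl
      where
      open ≡-Reasoning
      k+[l∸k]≡l : k + (l ∸ k) ≡ l
      k+[l∸k]≡l = m+[n∸m]≡n (ℕ.<⇒≤ k<l)
      even-difference : ∀ s → parity (l ∸ k) ≡ s → parity k ≡ parity l
      even-difference 1ℙ odd = ⊥-elim (no-odd-orbit (iterate f i k) (l ∸ k) odd (begin
        iterate f (iterate f i k) (l ∸ k) ≡⟨ iterate-+ f i k (l ∸ k) ⟨
        iterate f i (k + (l ∸ k))         ≡⟨ cong (iterate f i) k+[l∸k]≡l ⟩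
        iterate f i l                     ≡⟨ eq ⟨
        iterate f i k                     ∎))
      even-difference 0ℙ even = begin
        parity k                        ≡⟨ ℙ.+-identityʳ (parity k) ⟨
        parity k ℙ.+ 0ℙ                 ≡⟨ cong (parity k ℙ.+_) even ⟨
        parity k ℙ.+ parity (l ∸ k)     ≡⟨ +-homo-+ k (l ∸ k) ⟨
        parity (k + (l ∸ k))            ≡⟨ cong parity k+[l∸k]≡l ⟩
        parity l                        ∎

    iterate-≡⇒parity : ∀ i k l → iterate f i k ≡ iterate f i l → parity k ≡ parity l
    iterate-≡⇒parity i k l eq with ℕ.<-cmp k l
    ... | tri< k<l _ _  = iterate-<⇒parity i k<l eq
    ... | tri≈ _ refl _ = refl
    ... | tri> _ _ l<k  = sym (iterate-<⇒parity i l<k (sym eq))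

    -- From `r`, both `b + suc a′` and `b′ + a` steps lead to the iterate of `i` with exponent
    -- `a + suc a′`, so these numbers have equal parity. The witnesses are arbitrary because those
    -- chosen for `i` and `f i` are unrelated.
    meet-parity : ∀ i r ((a , b , _) : Meet i r) ((a′ , b′ , _) : Meet (f i) r) →
                  parity a′ ℙ.+ parity b′ ≡ (parity a ℙ.+ parity b) ⁻¹
    meet-parity i r (a , b , eq) (a′ , b′ , eq′) =
      rearrange (parity a) (parity b) (parity a′) (parity b′) (begin
        parity b ℙ.+ parity a′ ⁻¹     ≡⟨ cong (parity b ℙ.+_) (⁻¹-suc a′) ⟩
        parity b ℙ.+ parity (suc a′)  ≡⟨ +-homo-+ b (suc a′) ⟨
        parity (b + suc a′)           ≡⟨ iterate-≡⇒parity r (b + suc a′) (b′ + a) common ⟩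
        parity (b′ + a)               ≡⟨ +-homo-+ b′ a ⟩
        parity b′ ℙ.+ parity a        ∎)
      where
      open ≡-Reasoning
      ⁻¹-suc : ∀ k → parity k ⁻¹ ≡ parity (suc k)
      ⁻¹-suc k = trans (cong _⁻¹ (sym (ℙ.suc-homo-⁻¹ k))) (ℙ.⁻¹-involutive (parity (suc k)))
      common : iterate f r (b + suc a′) ≡ iterate f r (b′ + a)
      common = begin
        iterate f r (b + suc a′)               ≡⟨ iterate-+ f r b (suc a′) ⟩
        iterate f (iterate f r b) (suc a′)     ≡⟨ cong (λ j → iterate f j (suc a′)) eq ⟨
        iterate f (iterate f i a) (suc a′)     ≡⟨ iterate-comm f i a (suc a′) ⟩
        iterate f (iterate f i (suc a′)) a     ≡⟨ cong (λ j → iterate f j a) eq′ ⟩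
        iterate f (iterate f r b′) a           ≡⟨ iterate-+ f r b′ a ⟨
        iterate f r (b′ + a)                   ∎
      rearrange : ∀ p q p′ q′ → q ℙ.+ p′ ⁻¹ ≡ q′ ℙ.+ p → p′ ℙ.+ q′ ≡ (p ℙ.+ q) ⁻¹
      -- The eight patterns left out contradict the hypothesis.
      rearrange 0ℙ 0ℙ 0ℙ 1ℙ refl = refl
      rearrange 0ℙ 0ℙ 1ℙ 0ℙ refl = refl
      rearrange 0ℙ 1ℙ 0ℙ 0ℙ refl = refl
      rearrange 0ℙ 1ℙ 1ℙ 1ℙ refl = refl
      rearrange 1ℙ 0ℙ 0ℙ 0ℙ refl = refl
      rearrange 1ℙ 0ℙ 1ℙ 1ℙ refl = refl
      rearrange 1ℙ 1ℙ 0ℙ 1ℙ refl = refl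
      rearrange 1ℙ 1ℙ 1ℙ 0ℙ refl = refl

    -- The colour of i is the parity of the length of a path from i to the root of its component.
    two-colouring : ∃ λ (g : Fin n → Bool) → ∀ i → g (f i) ≡ not (g i)
    two-colouring = g , alternates
      where
      g : Fin n → Bool
      g i = let _ , (a , b , _) , _ = root i in does (parity a ℙ.+ parity b ℙ.≟ 1ℙ)
      does-⁻¹ : ∀ p → does (p ⁻¹ ℙ.≟ 1ℙ) ≡ not (does (p ℙ.≟ 1ℙ))
      does-⁻¹ 0ℙ = refl
      does-⁻¹ 1ℙ = refl
      alternates : ∀ i → g (f i) ≡ not (g i)
      -- Identifying the two roots lets both parities refer to the same `r`.
      alternates i with r , m@(a , b , _) , _ ← root i | r′ , m′ , _ ← root (f i) | refl ← root-step i =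
        trans (cong (λ p → does (p ℙ.≟ 1ℙ)) (meet-parity i r m m′)) (does-⁻¹ (parity a ℙ.+ parity b))

-- Subsets and bijections

-- If `y` were missed, punching it out of the codomain would inject a finite set into a smaller one.
injective⇒surjective : ∀ {m} {h : Fin m → Fin m} → Injective _≡_ _≡_ h → ∀ y → ∃ λ x → h x ≡ y
injective⇒surjective {suc m} {h} inj y with any? (λ x → h x Fin.≟ y)
... | yes hit = hit
... | no miss = ⊥-elim (<⇒notInjective (ℕ.n<1+n m)
  (λ {x} {x′} → inj ∘ punchOut-injective {i = y} (avoid x) (avoid x′)))
  where
  avoid : ∀ x → y ≢ h x
  avoid x y≡hx = miss (x , sym y≡hx)

-- Preceded by the splitting of `Fin N` into two halves, `h` becomes an injective self-map of
-- `Fin N`, hence is onto.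
injective⇒↔ : ∀ {n N} → N ≡ 2 * n → (h : Fin n ⊎ Fin n → Fin N) → Injective _≡_ _≡_ h →
              (Fin n ⊎ Fin n) ↔ Fin N
injective⇒↔ {n} {N} N≡2n h inj = mk↔ₛ′ h (proj₁ ∘ preimage) (proj₂ ∘ preimage)
                                   (λ s → inj (proj₂ (preimage (h s))))
  where
  N≡n+n : N ≡ n + n
  N≡n+n = trans N≡2n (cong (n +_) (ℕ.+-identityʳ n))
  split : Fin N → Fin n ⊎ Fin n
  split x = splitAt n (subst Fin N≡n+n x)
  split-injective : Injective _≡_ _≡_ split
  split-injective {x} {y} eq = subst-injective N≡n+n
    (trans (sym (join-splitAt n n _)) (trans (cong (join n n) eq) (join-splitAt n n _)))
  preimage : ∀ y → ∃ λ s → h s ≡ y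
  preimage y with x , eq ← injective⇒surjective {h = h ∘ split} (split-injective ∘ inj) y = split x , eq

-- Balanced colourings and 2-variegation.

indicator : Bool → ℕ
indicator true  = 1
indicator false = 0

∣tabulate∣ : ∀ {n} (c : Fin n → Bool) → ∣ tabulate c ∣ ≡ sum (indicator ∘ c)
∣tabulate∣ {zero} c = refl
∣tabulate∣ {suc n} c with c zero
... | true  = cong suc (∣tabulate∣ (c ∘ suc))
... | false = ∣tabulate∣ (c ∘ suc)

∁-tabulate : ∀ {n} (c : Fin n → Bool) → ∁ (tabulate c) ≡ tabulate (not ∘ c)
∁-tabulate {zero} c = refl
∁-tabulate {suc n} c = cong (not (c zero) ∷_) (∁-tabulate (c ∘ suc))

∣p∣+∣∁p∣≡n : ∀ {n} (p : Subset n) → ∣ p ∣ + ∣ ∁ p ∣ ≡ n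
∣p∣+∣∁p∣≡n p = trans (cong (∣ p ∣ +_) (∣∁p∣≡n∸∣p∣ p)) (ℕ.m+[n∸m]≡n (∣p∣≤n p))

-- `Sum.swap` induces an involution of the vertices that reverses colours, so the two colour classes
-- have equal size. The partner of a vertex is adjacent to it, and any neighbour of the other colour
-- must be this partner. The criterion is stated for any graph, to serve for the graph and its line
-- graph alike.
twoVariegated : ∀ {n N} (G : Graph N) → let open Graph G in
  N ≡ 2 * n →
  (φ : (Fin n ⊎ Fin n) ↔ Fin N) → let open Inverse φ in
  (c : Fin n ⊎ Fin n → Bool) →
  (∀ s → c (Sum.swap s) ≡ not (c s)) →
  (∀ s → to s ~ to (Sum.swap s)) →
  (∀ s t → to s ~ to t → t ≡ Sum.swap s ⊎ c t ≡ c s) →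
  TwoVariegated G
twoVariegated {n} {N} G N≡2n φ c c-swap matched otherwise =
  n , N≡2n , P , ∣P∣≡n , trans (sym ∣P∣≡∣∁P∣) ∣P∣≡n , fromInside , fromOutside
  where
  open Graph G
  open Inverse φ
  open ≡-Reasoning

  colour : Fin N → Bool
  colour = c ∘ from

  partner : Fin N → Fin N
  partner = to ∘ Sum.swap ∘ from

  P : Subset N
  P = tabulate colour

  partner-involutive : ∀ v → partner (partner v) ≡ v
  partner-involutive v = begin
    to (Sum.swap (from (to (Sum.swap (from v))))) ≡⟨ cong (to ∘ Sum.swap) (strictlyInverseʳ _) ⟩
    to (Sum.swap (Sum.swap (from v)))             ≡⟨ cong to (swap-involutive (from v)) ⟩
    to (from v)                                   ≡⟨ strictlyInverseˡ v ⟩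
    v                                             ∎

  colour-partner : ∀ v → colour (partner v) ≡ not (colour v)
  colour-partner v = trans (cong c (strictlyInverseʳ _)) (c-swap (from v))

  partners : Permutation′ N
  partners = permutation partner partner partner-involutive partner-involutive

  ∣P∣≡∣∁P∣ : ∣ P ∣ ≡ ∣ ∁ P ∣
  ∣P∣≡∣∁P∣ = begin
    ∣ tabulate colour ∣                ≡⟨ ∣tabulate∣ colour ⟩
    sum (indicator ∘ colour)           ≡⟨ sum-permute _ partners ⟩
    sum (indicator ∘ colour ∘ partner) ≡⟨ sum-cong-≗ (cong indicator ∘ colour-partner) ⟩
    sum (indicator ∘ not ∘ colour)     ≡⟨ ∣tabulate∣ (not ∘ colour) ⟨
    ∣ tabulate (not ∘ colour) ∣        ≡⟨ cong ∣_∣ (∁-tabulate colour) ⟨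
    ∣ ∁ P ∣                            ∎

  ∣P∣≡n : ∣ P ∣ ≡ n
  ∣P∣≡n = ℕ.*-cancelˡ-≡ ∣ P ∣ n 2 (begin
    ∣ P ∣ + (∣ P ∣ + 0) ≡⟨ cong (∣ P ∣ +_) (trans (ℕ.+-identityʳ ∣ P ∣) ∣P∣≡∣∁P∣) ⟩
    ∣ P ∣ + ∣ ∁ P ∣     ≡⟨ ∣p∣+∣∁p∣≡n P ⟩
    N                   ≡⟨ N≡2n ⟩
    2 * n               ∎)

  ∈P⁺ : ∀ {v} → colour v ≡ true → v ∈ P
  ∈P⁺ {v} eq = lookup⇒[]= v P (trans (lookup∘tabulate colour v) eq)

  ∈P⁻ : ∀ {v} → v ∈ P → colour v ≡ true
  ∈P⁻ {v} v∈P = trans (sym (lookup∘tabulate colour v)) ([]=⇒lookup v∈P)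

  ∈∁P⁺ : ∀ {v} → colour v ≡ false → v ∈ ∁ P
  ∈∁P⁺ eq = x∉p⇒x∈∁p λ v∈P → contradiction (trans (sym eq) (∈P⁻ v∈P)) λ ()

  ∈∁P⁻ : ∀ {v} → v ∈ ∁ P → colour v ≡ false
  ∈∁P⁻ v∈∁P = ¬-not (x∈∁p⇒x∉p v∈∁P ∘ ∈P⁺)

  v~partner : ∀ v → v ~ partner v
  v~partner v = subst (_~ partner v) (strictlyInverseˡ v) (matched (from v))

  partner-unique : ∀ {v w} → colour w ≡ not (colour v) → v ~ w → partner v ≡ w
  partner-unique {v} {w} opposite v~w
    with otherwise (from v) (from w) (subst₂ _~_ (sym (strictlyInverseˡ v)) (sym (strictlyInverseˡ w)) v~w)
  ... | inj₁ eq   = trans (cong to (sym eq)) (strictlyInverseˡ w)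
  ... | inj₂ same = ⊥-elim (not-¬ same opposite)

  fromInside : ∀ v → v ∈ P → ∃! _≡_ λ w → w ∈ ∁ P × v ~ w
  fromInside v v∈P = partner v ,
    (∈∁P⁺ (trans (colour-partner v) (cong not (∈P⁻ v∈P))) , v~partner v) ,
    λ (w∈∁P , v~w) → partner-unique (trans (∈∁P⁻ w∈∁P) (cong not (sym (∈P⁻ v∈P)))) v~w

  fromOutside : ∀ v → v ∈ ∁ P → ∃! _≡_ λ w → w ∈ P × v ~ w
  fromOutside v v∈∁P = partner v ,
    (∈P⁺ (trans (colour-partner v) (cong not (∈∁P⁻ v∈∁P))) , v~partner v) ,
    λ (w∈P , v~w) → partner-unique (trans (∈P⁻ w∈P) (cong not (sym (∈∁P⁻ v∈∁P)))) v~w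

-- Enumerated subsets and duplicate-free lists.

element : ∀ {N} (p : Subset N) → Fin ∣ p ∣ → Fin N
element (true ∷ p)  zero    = zero
element (true ∷ p)  (suc k) = suc (element p k)
element (false ∷ p) k       = suc (element p k)

element-∈ : ∀ {N} (p : Subset N) k → element p k ∈ p
element-∈ (true ∷ p)  zero    = here
element-∈ (true ∷ p)  (suc k) = there (element-∈ p k)
element-∈ (false ∷ p) k       = there (element-∈ p k)

element-injective : ∀ {N} (p : Subset N) → Injective _≡_ _≡_ (element p)
element-injective (true ∷ p)  {zero}  {zero}  eq = refl
element-injective (true ∷ p)  {suc k} {suc l} eq = cong suc (element-injective p (Fin.suc-injective eq))
element-injective (false ∷ p) eq = element-injective p (Fin.suc-injective eq)

lookup-injective : ∀ {a} {A : Set a} {xs : List A} → Unique xs → ∀ {i j} →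
                   List.lookup xs i ≡ List.lookup xs j → i ≡ j
lookup-injective (x∉ ∷ u) {zero}  {zero}  eq = refl
lookup-injective (x∉ ∷ u) {zero}  {suc j} eq = ⊥-elim (All.lookup x∉ (∈-lookup j) eq)
lookup-injective (x∉ ∷ u) {suc i} {zero}  eq = ⊥-elim (All.lookup x∉ (∈-lookup i) (sym eq))
lookup-injective (x∉ ∷ u) {suc i} {suc j} eq = cong suc (lookup-injective u eq)

∈-doubleton : ∀ {a} {A : Set a} {xs : List A} {x y z} → length xs ≡ 2 →
  x ∈ₗ xs → y ∈ₗ xs → x ≢ y → z ∈ₗ xs → z ≡ x ⊎ z ≡ y
∈-doubleton {xs = _ ∷ _ ∷ []} _ (here refl)         (here refl)         x≢y _                   = ⊥-elim (x≢y refl)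
∈-doubleton {xs = _ ∷ _ ∷ []} _ (there (here refl)) (there (here refl)) x≢y _                   = ⊥-elim (x≢y refl)
∈-doubleton {xs = _ ∷ _ ∷ []} _ (here refl)         (there (here refl)) x≢y (here refl)         = inj₁ refl
∈-doubleton {xs = _ ∷ _ ∷ []} _ (here refl)         (there (here refl)) x≢y (there (here refl)) = inj₂ refl
∈-doubleton {xs = _ ∷ _ ∷ []} _ (there (here refl)) (here refl)         x≢y (here refl)         = inj₂ refl
∈-doubleton {xs = _ ∷ _ ∷ []} _ (there (here refl)) (here refl)         x≢y (there (here refl)) = inj₁ refl

-- Duplicate-free lists with the same members are permutations of each other.
unique-sameElements⇒length : ∀ {a} {A : Set a} {xs ys : List A} → Unique xs → Unique ys →
  (∀ {x} → x ∈ₗ xs → x ∈ₗ ys) → (∀ {x} → x ∈ₗ ys → x ∈ₗ xs) → length xs ≡ length ys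
unique-sameElements⇒length u v xs⊆ys ys⊆xs = ↭-length (∼bag⇒↭ (unique∧set⇒bag u v (mk⇔ xs⊆ys ys⊆xs)))

odd⇒%2≡1 : ∀ n → parity n ≡ 1ℙ → n % 2 ≡ 1
odd⇒%2≡1 1             _   = refl
odd⇒%2≡1 (suc (suc n)) odd = odd⇒%2≡1 n odd

-- Edges as unordered pairs of vertices

module EdgeProperties {N : ℕ} (G : Graph N) where
  open Graph G

  Joins : Edge → Vertex → Vertex → Set
  Joins e u v = endpoints e ≡ (u , v) ⊎ endpoints e ≡ (v , u)

  edges-unique : Unique edges
  edges-unique = filter⁺ _ (cartesianProduct⁺ (allFin⁺ N) (allFin⁺ N))

  endpoints-ordered : ∀ e → proj₁ (endpoints e) Fin.< proj₂ (endpoints e)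
  endpoints-ordered e = proj₁ (proj₂ (∈-filter⁻ _ {xs = cartesianProduct (allFin N) (allFin N)} (∈-lookup e)))

  endpoints-adjacent : ∀ e → proj₁ (endpoints e) ~ proj₂ (endpoints e)
  endpoints-adjacent e = proj₂ (proj₂ (∈-filter⁻ _ {xs = cartesianProduct (allFin N) (allFin N)} (∈-lookup e)))

  joins-sym : ∀ {e u v} → Joins e u v → Joins e v u
  joins-sym = Sum.swap

  joins⇒~ : ∀ {e u v} → Joins e u v → u ~ v
  joins⇒~ {e} (inj₁ eq) = subst (uncurry _~_) eq (endpoints-adjacent e)
  joins⇒~ {e} (inj₂ eq) = ~-sym (subst (uncurry _~_) eq (endpoints-adjacent e))

  joins⇒≢ : ∀ {e u v} → Joins e u v → u ≢ v
  joins⇒≢ j u≡v = ~-irrefl u≡v (joins⇒~ j)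

  ordered-edge : ∀ {u v} → u Fin.< v → u ~ v → ∃ λ e → endpoints e ≡ (u , v)
  ordered-edge {u} {v} u<v u~v = index uv∈ , sym (lookup-index uv∈)
    where
    uv∈ : (u , v) ∈ₗ edges
    uv∈ = ∈-filter⁺ _ (∈-cartesianProduct⁺ (∈-allFin u) (∈-allFin v)) (u<v , u~v)

  ~⇒joins : ∀ {u v} → u ~ v → ∃ λ e → Joins e u v
  ~⇒joins {u} {v} u~v with Fin.<-cmp u v
  ... | tri< u<v _ _ with e , eq ← ordered-edge u<v u~v = e , inj₁ eq
  ... | tri≈ _ u≡v _ = ⊥-elim (~-irrefl u≡v u~v)
  ... | tri> _ _ v<u with e , eq ← ordered-edge v<u (~-sym u~v) = e , inj₂ eq

  endpoints-antisym : ∀ {e f u v} → endpoints e ≡ (u , v) → endpoints f ≢ (v , u)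
  endpoints-antisym {e} {f} eq eq′ = ℕ.<-asym
    (subst (uncurry Fin._<_) eq (endpoints-ordered e))
    (subst (uncurry Fin._<_) eq′ (endpoints-ordered f))

  -- Equal orientations give the same entry of a duplicate-free list; opposite ones contradict that
  -- the smaller endpoint comes first.
  joins-unique : ∀ {e f u v} → Joins e u v → Joins f u v → e ≡ f
  joins-unique         (inj₁ p) (inj₁ q) = lookup-injective edges-unique (trans p (sym q))
  joins-unique         (inj₂ p) (inj₂ q) = lookup-injective edges-unique (trans p (sym q))
  joins-unique {e} {f} (inj₁ p) (inj₂ q) = ⊥-elim (endpoints-antisym {e} {f} p q)
  joins-unique {e} {f} (inj₂ p) (inj₁ q) = ⊥-elim (endpoints-antisym {f} {e} q p)

  joins⇒incident : ∀ {e u v} → Joins e u v → Incident u e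
  joins⇒incident (inj₁ eq) = inj₁ (cong proj₁ (sym eq))
  joins⇒incident (inj₂ eq) = inj₂ (cong proj₂ (sym eq))

  incident⇒end : ∀ {e u v w} → Joins e u v → Incident w e → w ≡ u ⊎ w ≡ v
  incident⇒end (inj₁ eq) (inj₁ w≡) = inj₁ (trans w≡ (cong proj₁ eq))
  incident⇒end (inj₁ eq) (inj₂ w≡) = inj₂ (trans w≡ (cong proj₂ eq))
  incident⇒end (inj₂ eq) (inj₁ w≡) = inj₂ (trans w≡ (cong proj₁ eq))
  incident⇒end (inj₂ eq) (inj₂ w≡) = inj₁ (trans w≡ (cong proj₂ eq))

  joins-ends : ∀ {e u v x y} → Joins e u v → Joins e x y → (x ≡ u × y ≡ v) ⊎ (x ≡ v × y ≡ u)
  joins-ends (inj₁ p) (inj₁ q) = inj₁ (,-injective (trans (sym q) p))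
  joins-ends (inj₁ p) (inj₂ q) = inj₂ (swap (,-injective (trans (sym q) p)))
  joins-ends (inj₂ p) (inj₁ q) = inj₂ (,-injective (trans (sym q) p))
  joins-ends (inj₂ p) (inj₂ q) = inj₁ (swap (,-injective (trans (sym q) p)))

  step⇒on : ∀ {e u v ws} → Joins e u v → (u , v) ∈ₗ steps ws → e On ws
  step⇒on (inj₁ eq) uv∈ = inj₁ (subst (_∈ₗ _) (sym eq) uv∈)
  step⇒on (inj₂ eq) uv∈ = inj₂ (subst (λ uv → swap uv ∈ₗ _) (sym eq) uv∈)

  step-ends : ∀ {u v} ws → (u , v) ∈ₗ steps ws → u ∈ₗ ws × v ∈ₗ ws
  step-ends (_ ∷ _ ∷ _)  (here refl) = here refl , there (here refl)
  step-ends (_ ∷ w ∷ ws) (there uv∈) with u∈ , v∈ ← step-ends (w ∷ ws) uv∈ = there u∈ , there v∈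

  on⇒end∈ : ∀ {e u v ws} → Joins e u v → e On ws → v ∈ₗ ws
  on⇒end∈ (inj₁ eq) (inj₁ on) = proj₂ (step-ends _ (subst (_∈ₗ _) eq on))
  on⇒end∈ (inj₁ eq) (inj₂ on) = proj₁ (step-ends _ (subst (λ uv → swap uv ∈ₗ _) eq on))
  on⇒end∈ (inj₂ eq) (inj₁ on) = proj₁ (step-ends _ (subst (_∈ₗ _) eq on))
  on⇒end∈ (inj₂ eq) (inj₂ on) = proj₂ (step-ends _ (subst (λ uv → swap uv ∈ₗ _) eq on))

  module _ (p : XYZPath) where
    open XYZPath p

    on-path⁺ : ∀ {e} → Joins e x y ⊎ Joins e y z → e On vertices
    on-path⁺ (inj₁ j) = step⇒on {ws = vertices} j (here refl)
    on-path⁺ (inj₂ j) = step⇒on {ws = vertices} j (there (here refl))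

    on-path⁻ : ∀ {e} → e On vertices → Joins e x y ⊎ Joins e y z
    on-path⁻ (inj₁ (here eq))         = inj₁ (inj₁ eq)
    on-path⁻ (inj₁ (there (here eq))) = inj₂ (inj₁ eq)
    on-path⁻ (inj₂ (here eq))         = inj₁ (inj₂ (cong swap eq))
    on-path⁻ (inj₂ (there (here eq))) = inj₂ (inj₂ (cong swap eq))

    middle-incident : ∀ {e} → e On vertices → Incident y e
    middle-incident on with on-path⁻ on
    ... | inj₁ j = joins⇒incident (joins-sym j)
    ... | inj₂ j = joins⇒incident j

    -- The neighbour list of `y` has length 2 and already contains the distinct vertices `x` and
    -- `z`.
    middle-neighbour : ∀ {w} → y ~ w → w ≡ x ⊎ w ≡ z
    middle-neighbour y~w = ∈-doubleton degree-y (neighbour (~-sym x~y)) (neighbour y~z) x≢z (neighbour y~w)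
      where
      neighbour : ∀ {w} → y ~ w → w ∈ₗ filter (y ~?_) (allFin N)
      neighbour {w} = ∈-filter⁺ _ (∈-allFin w)

  -- An ⟨xyz⟩ path read from the end at which the edge e lies.
  record OrientedFrom (e : Edge) (p : XYZPath) : Set where
    field
      X Y Z             : Vertex
      link              : Edge
      e-joins           : Joins e X Y
      link-joins        : Joins link Y Z
      X≢Z               : X ≢ Z
      middle-neighbours : ∀ {w} → Y ~ w → w ≡ X ⊎ w ≡ Z
      on⁺               : ∀ {f} → Joins f X Y ⊎ Joins f Y Z → f On XYZPath.vertices p
      on⁻               : ∀ {f} → f On XYZPath.vertices p → Joins f X Y ⊎ Joins f Y Z

  orient : ∀ {e} p → e On XYZPath.vertices p → OrientedFrom e p
  orient p on with on-path⁻ p on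
  ... | inj₁ j = record
    { X = x ; Y = y ; Z = z
    ; link = proj₁ (~⇒joins y~z)
    ; e-joins = j
    ; link-joins = proj₂ (~⇒joins y~z)
    ; X≢Z = x≢z
    ; middle-neighbours = middle-neighbour p
    ; on⁺ = on-path⁺ p
    ; on⁻ = on-path⁻ p
    }
    where open XYZPath p
  ... | inj₂ j = record
    { X = z ; Y = y ; Z = x
    ; link = proj₁ (~⇒joins (~-sym x~y))
    ; e-joins = joins-sym j
    ; link-joins = proj₂ (~⇒joins (~-sym x~y))
    ; X≢Z = x≢z ∘ sym
    ; middle-neighbours = Sum.swap ∘ middle-neighbour p
    ; on⁺ = on-path⁺ p ∘ Sum.map joins-sym joins-sym ∘ Sum.swap
    ; on⁻ = Sum.map joins-sym joins-sym ∘ Sum.swap ∘ on-path⁻ p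
    }
    where open XYZPath p

-- Cycles and colourings of a subdivided functional graph

-- Through `φ` and `ψ` every vertex is some `X i` or `Y i`, and every edge some `mate i` or
-- `link i`. Thus `Y i` subdivides the arc from `i` to `next i`.
module SubdividedFunctionalGraph {n N : ℕ} (G : Graph N)
  (φ : (Fin n ⊎ Fin n) ↔ Fin N) (ψ : (Fin n ⊎ Fin n) ↔ Graph.Edge G) (next : Fin n → Fin n)
  (mate-joins : ∀ i → EdgeProperties.Joins G (Inverse.to ψ (inj₁ i))
                        (Inverse.to φ (inj₁ i)) (Inverse.to φ (inj₂ i)))
  (link-joins : ∀ i → EdgeProperties.Joins G (Inverse.to ψ (inj₂ i))
                        (Inverse.to φ (inj₂ i)) (Inverse.to φ (inj₁ (next i))))
  where

  open Graph G
  open EdgeProperties G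

  vertex : Fin n ⊎ Fin n → Vertex
  vertex = Inverse.to φ

  edge : Fin n ⊎ Fin n → Edge
  edge = Inverse.to ψ

  X Y : Fin n → Vertex
  X = vertex ∘ inj₁
  Y = vertex ∘ inj₂

  mate link : Fin n → Edge
  mate = edge ∘ inj₁
  link = edge ∘ inj₂

  vertex-injective : Injective _≡_ _≡_ vertex
  vertex-injective = Injection.injective (↔⇒↣ φ)

  edge-injective : Injective _≡_ _≡_ edge
  edge-injective = Injection.injective (↔⇒↣ ψ)

  X-injective : Injective _≡_ _≡_ X
  X-injective = inj₁-injective ∘ vertex-injective

  Y-injective : Injective _≡_ _≡_ Y
  Y-injective = inj₂-injective ∘ vertex-injective

  X≢Y : ∀ {i j} → X i ≢ Y j
  X≢Y eq with () ← vertex-injective eq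

  -- At a fixed point `mate i` and `link i` would be parallel edges. This disposes of closed orbits
  -- of length 1, which give no cycle.
  next-irrefl : ∀ i → next i ≢ i
  next-irrefl i next-i≡i
    with () ← edge-injective (joins-unique (mate-joins i)
                (joins-sym (subst (λ j → Joins (link i) (Y i) (X j)) next-i≡i (link-joins i))))

  adjacent-cases : ∀ s t → vertex s ~ vertex t →
    ∃ λ i → (s ≡ inj₁ i × t ≡ inj₂ i) ⊎ (s ≡ inj₂ i × t ≡ inj₁ i) ⊎
            (s ≡ inj₂ i × t ≡ inj₁ (next i)) ⊎ (s ≡ inj₁ (next i) × t ≡ inj₂ i)
  adjacent-cases s t s~t with e , e-joins ← ~⇒joins s~t =
    -- Writing the edge as an image under `ψ` reduces the claim to mates and links.
    by-edge (Inverse.from ψ e) (subst (λ e → Joins e _ _) (sym (Inverse.strictlyInverseˡ ψ e)) e-joins)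
    where
    by-edge : ∀ r → Joins (edge r) (vertex s) (vertex t) →
      ∃ λ i → (s ≡ inj₁ i × t ≡ inj₂ i) ⊎ (s ≡ inj₂ i × t ≡ inj₁ i) ⊎
              (s ≡ inj₂ i × t ≡ inj₁ (next i)) ⊎ (s ≡ inj₁ (next i) × t ≡ inj₂ i)
    by-edge (inj₁ i) r-joins with joins-ends (mate-joins i) r-joins
    ... | inj₁ (p , q) = i , inj₁ (vertex-injective p , vertex-injective q)
    ... | inj₂ (p , q) = i , inj₂ (inj₁ (vertex-injective p , vertex-injective q))
    by-edge (inj₂ i) r-joins with joins-ends (link-joins i) r-joins
    ... | inj₁ (p , q) = i , inj₂ (inj₂ (inj₁ (vertex-injective p , vertex-injective q)))
    ... | inj₂ (p , q) = i , inj₂ (inj₂ (inj₂ (vertex-injective p , vertex-injective q)))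

  module Colouring (g : Fin n → Bool) (alternates : ∀ i → g (next i) ≡ not (g i)) where

    -- Read through `φ` this colours vertices, read through `ψ` it colours edges. When `g`
    -- alternates, `link i` gets the colour of its end `X (next i)`.
    colour : Fin n ⊎ Fin n → Bool
    colour = [ g , not ∘ g ]

    colour-swap : ∀ s → colour (Sum.swap s) ≡ not (colour s)
    colour-swap (inj₁ i) = refl
    colour-swap (inj₂ i) = sym (not-involutive (g i))

    vertices-matched : ∀ s → vertex s ~ vertex (Sum.swap s)
    vertices-matched (inj₁ i) = joins⇒~ (mate-joins i)
    vertices-matched (inj₂ i) = ~-sym (joins⇒~ (mate-joins i))

    -- A mate joins swapped vertices, while a link joins `Y i` to `X (next i)`, both of colour
    -- `not (g i)`.
    adjacent⇒swap⊎sameColour : ∀ s t → vertex s ~ vertex t → t ≡ Sum.swap s ⊎ colour t ≡ colour s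
    adjacent⇒swap⊎sameColour s t s~t with adjacent-cases s t s~t
    ... | i , inj₁ (refl , refl)               = inj₁ refl
    ... | i , inj₂ (inj₁ (refl , refl))        = inj₁ refl
    ... | i , inj₂ (inj₂ (inj₁ (refl , refl))) = inj₂ (alternates i)
    ... | i , inj₂ (inj₂ (inj₂ (refl , refl))) = inj₂ (sym (alternates i))

    -- Around Y i there are just mate i and link i; all edges around X j have the colour of X j.
    incident-cases : ∀ s {v} → Incident v (edge s) →
      (∃ λ i → v ≡ Y i × (s ≡ inj₁ i ⊎ s ≡ inj₂ i)) ⊎ (∃ λ j → v ≡ X j × colour s ≡ g j)
    incident-cases (inj₁ i) inc with incident⇒end (mate-joins i) inc
    ... | inj₁ v≡X = inj₂ (i , v≡X , refl)
    ... | inj₂ v≡Y = inj₁ (i , v≡Y , inj₁ refl)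
    incident-cases (inj₂ i) inc with incident⇒end (link-joins i) inc
    ... | inj₁ v≡Y = inj₁ (i , v≡Y , inj₂ refl)
    ... | inj₂ v≡X = inj₂ (next i , v≡X , sym (alternates i))

    edges-matched : ∀ s → Graph._~_ (LineGraph G) (edge s) (edge (Sum.swap s))
    edges-matched (inj₁ i) = (λ eq → case edge-injective eq of λ ()) ,
      Y i , joins⇒incident (joins-sym (mate-joins i)) , joins⇒incident (link-joins i)
    edges-matched (inj₂ i) = (λ eq → case edge-injective eq of λ ()) ,
      Y i , joins⇒incident (link-joins i) , joins⇒incident (joins-sym (mate-joins i))

    -- Edges that meet at some `Y i` are its mate and its link; edges that meet at some `X j` both
    -- have the colour `g j`.
    share⇒swap⊎sameColour : ∀ s t → Graph._~_ (LineGraph G) (edge s) (edge t) →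
                            t ≡ Sum.swap s ⊎ colour t ≡ colour s
    share⇒swap⊎sameColour s t (s≢t , v , v∈s , v∈t) with incident-cases s v∈s | incident-cases t v∈t
    ... | inj₁ (i , v≡Yi , _) | inj₂ (j , v≡Xj , _) = ⊥-elim (X≢Y (trans (sym v≡Xj) v≡Yi))
    ... | inj₂ (j , v≡Xj , _) | inj₁ (i , v≡Yi , _) = ⊥-elim (X≢Y (trans (sym v≡Xj) v≡Yi))
    ... | inj₂ (j , v≡Xj , s-colour) | inj₂ (k , v≡Xk , t-colour)
        with refl ← X-injective (trans (sym v≡Xj) v≡Xk) = inj₂ (trans t-colour (sym s-colour))
    ... | inj₁ (i , v≡Yi , s-side) | inj₁ (j , v≡Yj , t-side)
        with refl ← Y-injective (trans (sym v≡Yi) v≡Yj) = inj₁ (opposite s-side t-side)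
      where
      opposite : s ≡ inj₁ i ⊎ s ≡ inj₂ i → t ≡ inj₁ i ⊎ t ≡ inj₂ i → t ≡ Sum.swap s
      opposite (inj₁ refl) (inj₁ refl) = ⊥-elim (s≢t refl)
      opposite (inj₁ refl) (inj₂ refl) = refl
      opposite (inj₂ refl) (inj₁ refl) = refl
      opposite (inj₂ refl) (inj₂ refl) = ⊥-elim (s≢t refl)

    bothTwoVariegated : N ≡ 2 * n → size ≡ 2 * n → TwoVariegated G × TwoVariegated (LineGraph G)
    bothTwoVariegated N≡2n size≡2n =
      twoVariegated G N≡2n φ colour colour-swap vertices-matched adjacent⇒swap⊎sameColour ,
      twoVariegated (LineGraph G) size≡2n ψ colour colour-swap edges-matched share⇒swap⊎sameColour

  -- Closed orbits as cycles of the graph.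

  subdivide : List (Fin n) → List Vertex
  subdivide []       = []
  subdivide (i ∷ is) = X i ∷ Y i ∷ subdivide is

  ∈-subdivide⁻ : ∀ {s} is → vertex s ∈ₗ subdivide is → reduce s ∈ₗ is
  ∈-subdivide⁻ (i ∷ is) (here eq)         rewrite vertex-injective eq = here refl
  ∈-subdivide⁻ (i ∷ is) (there (here eq)) rewrite vertex-injective eq = here refl
  ∈-subdivide⁻ (i ∷ is) (there (there s∈)) = there (∈-subdivide⁻ is s∈)

  subdivide-unique : ∀ {is} → Unique is → Unique (subdivide is)
  subdivide-unique []               = []
  subdivide-unique {i ∷ is} (i∉ ∷ u) =
    ¬Any⇒All¬ _ (λ { (here eq) → X≢Y eq ; (there X∈) → i∉is (∈-subdivide⁻ {inj₁ i} is X∈) }) ∷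
    ¬Any⇒All¬ _ (i∉is ∘ ∈-subdivide⁻ {inj₂ i} is) ∷
    subdivide-unique u
    where
    i∉is : ¬ (i ∈ₗ is)
    i∉is = All¬⇒¬Any i∉

  -- The last vertex is not assumed to be `X j`, so that induction on `k` can pass through walks
  -- that are not closed.
  walk : Fin n → ℕ → List Vertex
  walk j k = subdivide (List.iterate next j k) ∷ʳ X (iterate next j k)

  walk-steps⁻ : ∀ {p} {P : Vertex × Vertex → Set p} →
    (∀ i → P (X i , Y i)) → (∀ i → P (Y i , X (next i))) → ∀ j k → All P (steps (walk j k))
  walk-steps⁻ XY YX j zero          = []
  walk-steps⁻ XY YX j (suc zero)    = XY j ∷ YX j ∷ []
  walk-steps⁻ XY YX j (suc (suc k)) = XY j ∷ YX j ∷ walk-steps⁻ XY YX (next j) (suc k)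

  walk-steps⁺ : ∀ {i} j k → i ∈ₗ List.iterate next j k →
    (X i , Y i) ∈ₗ steps (walk j k) × (Y i , X (next i)) ∈ₗ steps (walk j k)
  walk-steps⁺ j (suc zero)    (here refl) = here refl , there (here refl)
  walk-steps⁺ j (suc (suc k)) (here refl) = here refl , there (here refl)
  walk-steps⁺ j (suc (suc k)) (there i∈) =
    let XY∈ , YX∈ = walk-steps⁺ (next j) (suc k) i∈ in there (there XY∈) , there (there YX∈)

  Y∈walk : ∀ {i} j k → Y i ∈ₗ walk j k → i ∈ₗ List.iterate next j k
  Y∈walk j k Y∈ with ∈-++⁻ (subdivide (List.iterate next j k)) Y∈
  ... | inj₁ Y∈′       = ∈-subdivide⁻ _ Y∈′
  ... | inj₂ (here eq) = ⊥-elim (X≢Y (sym eq))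

  module _ (paths : Fin n → XYZPath)
    (mate-on : ∀ i → mate i On XYZPath.vertices (paths i))
    (on-cases : ∀ i e → e On XYZPath.vertices (paths i) → Joins e (X i) (Y i) ⊎ Joins e (Y i) (X (next i)))
    where

    -- A contained path has its mate, hence its middle vertex, on the cycle, so its index lies in
    -- the orbit. Conversely both edges of a path indexed by the orbit are steps of the walk. Length
    -- at least 2 gives the cycle at least four vertices.
    orbit-cycle : ∀ j l → let k = 2 + l in iterate next j k ≡ j → Unique (List.iterate next j k) →
      ∃ λ c → countContained c paths ≡ k
    orbit-cycle j l closed u = cycle , (begin
      length (filter contained? (allFin n))
        ≡⟨ unique-sameElements⇒length (filter⁺ contained? (allFin⁺ n)) u contained⇒∈ ∈⇒contained ⟩
      length (List.iterate next j k)       ≡⟨ length-iterate next j k ⟩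
      k                                    ∎)
      where
      open ≡-Reasoning
      k : ℕ
      k = 2 + l
      walk≡ : walk j k ≡ subdivide (List.iterate next j k) ∷ʳ X j
      walk≡ = cong (λ i → subdivide (List.iterate next j k) ∷ʳ X i) closed
      cycle : Cycle
      cycle = record
        { base     = X j
        ; rest     = Y j ∷ subdivide (List.iterate next (next j) (suc l))
        ; distinct = subdivide-unique u
        ; long     = s≤s (s≤s (s≤s z≤n))
        ; adjacent = subst (All (uncurry _~_) ∘ steps) walk≡
            (walk-steps⁻ (joins⇒~ ∘ mate-joins) (joins⇒~ ∘ link-joins) j k)
        }
      contained? : ∀ i → Dec (Contains cycle (paths i))
      contained? i = Contains? cycle (paths i)
      contained⇒∈ : ∀ {i} → i ∈ₗ filter contained? (allFin n) → i ∈ₗ List.iterate next j k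
      contained⇒∈ {i} i∈ = Y∈walk j k (subst (Y i ∈ₗ_) (sym walk≡)
        (on⇒end∈ (mate-joins i) (proj₂ (∈-filter⁻ contained? {xs = allFin n} i∈) (mate i) (mate-on i))))
      ∈⇒contained : ∀ {i} → i ∈ₗ List.iterate next j k → i ∈ₗ filter contained? (allFin n)
      ∈⇒contained {i} i∈ = ∈-filter⁺ contained? (∈-allFin i) λ e on → [
          (λ e-joins → step⇒on {ws = Cycle.closedWalk cycle} e-joins (proj₁ steps∈)) ,
          (λ e-joins → step⇒on {ws = Cycle.closedWalk cycle} e-joins (proj₂ steps∈)) ]′ (on-cases i e on)
        where
        steps∈ : (X i , Y i) ∈ₗ steps (Cycle.closedWalk cycle) ×
                 (Y i , X (next i)) ∈ₗ steps (Cycle.closedWalk cycle)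
        steps∈ = subst (λ ws → (X i , Y i) ∈ₗ steps ws × (Y i , X (next i)) ∈ₗ steps ws) walk≡
                   (walk-steps⁺ j k i∈)

    -- An odd closed orbit yields a simple one. Its length is not 0 by parity and not 1 by
    -- `next-irrefl`, so it traces a cycle with an odd number of paths.
    no-odd-orbit : (∀ c → ¬ (countContained c paths % 2 ≡ 1)) →
                   ∀ i k → parity k ≡ 1ℙ → iterate next i k ≢ i
    no-odd-orbit even-cycles i k odd closed with simple-odd-orbit next Fin._≟_ i k closed odd
    ... | j , 1 , closed′ , _ , _ = next-irrefl j closed′
    ... | j , d@(suc (suc l)) , closed′ , odd′ , u
        with c , count≡d ← orbit-cycle j l closed′ u =
      even-cycles c (trans (cong (_% 2) count≡d) (odd⇒%2≡1 d odd′))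

-- Decomposition of the graph into its ⟨xyz⟩ paths

module _ {n : ℕ} (G : Graph (2 * n)) where
  open Graph G
  open EdgeProperties G

  -- Two marked edges on one path would share its middle vertex. So sending each of the `n` marked
  -- edges to its path is injective, hence onto the `n` paths.
  markedEdges : (paths : Fin n → XYZPath) (M : Subset size) →
    ∣ M ∣ ≡ n → PairwiseNonadjacent M →
    (∀ e → e ∈ M → ∃! _≡_ (λ i → e On XYZPath.vertices (paths i))) →
    ∀ i → ∃ λ e → e ∈ M × e On XYZPath.vertices (paths i)
  markedEdges paths M ∣M∣≡n nonadjacent exact i =
    let k , pathOf-k≡i = injective⇒surjective {h = pathOf ∘ subst Fin (sym ∣M∣≡n)}
          (subst-injective (sym ∣M∣≡n) ∘ pathOf-injective) i
        l = subst Fin (sym ∣M∣≡n) k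
    in element M l , element-∈ M l ,
       subst (λ i → element M l On XYZPath.vertices (paths i)) pathOf-k≡i (pathOf-on l)
    where
    pathOf : Fin ∣ M ∣ → Fin n
    pathOf k = proj₁ (exact (element M k) (element-∈ M k))
    pathOf-on : ∀ k → element M k On XYZPath.vertices (paths (pathOf k))
    pathOf-on k = proj₁ (proj₂ (exact (element M k) (element-∈ M k)))
    pathOf-injective : Injective _≡_ _≡_ pathOf
    pathOf-injective {k} {l} eq with element M k Fin.≟ element M l
    ... | yes same = element-injective M same
    ... | no differ = ⊥-elim (nonadjacent (element-∈ M k) (element-∈ M l) differ
      ( XYZPath.y (paths (pathOf k))
      , middle-incident (paths (pathOf k)) (pathOf-on k)
      , subst (λ i → Incident (XYZPath.y (paths i)) (element M l)) (sym eq)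
          (middle-incident (paths (pathOf l)) (pathOf-on l))))

  module Decomposition (paths : Fin n → XYZPath)
    (disjoint : ∀ i j → i ≢ j → EdgeDisjoint (paths i) (paths j))
    (M : Subset size) (nonadjacent : PairwiseNonadjacent M)
    (marked : ∀ i → ∃ λ e → e ∈ M × e On XYZPath.vertices (paths i))
    (size≡2n : size ≡ 2 * n)
    where

    mate : Fin n → Edge
    mate i = proj₁ (marked i)

    mate∈M : ∀ i → mate i ∈ M
    mate∈M i = proj₁ (proj₂ (marked i))

    mate-on : ∀ i → mate i On XYZPath.vertices (paths i)
    mate-on i = proj₂ (proj₂ (marked i))

    oriented : ∀ i → OrientedFrom (mate i) (paths i)
    oriented i = orient (paths i) (mate-on i)

    module Path (i : Fin n) = OrientedFrom (oriented i)
    open Path using (X; Y; Z; link)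

    common-edge⇒≡ : ∀ i j {e f} → e ≡ f →
      e On XYZPath.vertices (paths i) → f On XYZPath.vertices (paths j) → i ≡ j
    common-edge⇒≡ i j {e} refl on-i on-j with i Fin.≟ j
    ... | yes i≡j = i≡j
    ... | no i≢j  = ⊥-elim (disjoint i j i≢j (e , on-i , on-j))

    link-on : ∀ i → link i On XYZPath.vertices (paths i)
    link-on i = Path.on⁺ i (inj₂ (Path.link-joins i))

    mate≢link : ∀ i → mate i ≢ link i
    mate≢link i eq
      with joins-ends (Path.e-joins i)
                      (subst (λ e → Joins e (Y i) (Z i)) (sym eq) (Path.link-joins i))
    ... | inj₁ (Y≡X , _) = joins⇒≢ (Path.e-joins i) (sym Y≡X)
    ... | inj₂ (_ , Z≡X) = Path.X≢Z i (sym Z≡X)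

    edgeAt : Fin n ⊎ Fin n → Edge
    edgeAt = [ mate , link ]

    -- Disjointness separates different paths, and `mate≢link` the two edges of one path. As there
    -- are `2 * n` edges, the paths use all of them.
    edgeAt-injective : Injective _≡_ _≡_ edgeAt
    edgeAt-injective {inj₁ i} {inj₁ j} eq = cong inj₁ (common-edge⇒≡ i j eq (mate-on i) (mate-on j))
    edgeAt-injective {inj₂ i} {inj₂ j} eq = cong inj₂ (common-edge⇒≡ i j eq (link-on i) (link-on j))
    edgeAt-injective {inj₁ i} {inj₂ j} eq with refl ← common-edge⇒≡ i j eq (mate-on i) (link-on j) =
      ⊥-elim (mate≢link i eq)
    edgeAt-injective {inj₂ i} {inj₁ j} eq with refl ← common-edge⇒≡ i j eq (link-on i) (mate-on j) =
      ⊥-elim (mate≢link i (sym eq))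

    mates-share⇒≡ : ∀ {i j v} → Incident v (mate i) → Incident v (mate j) → i ≡ j
    mates-share⇒≡ {i} {j} {v} inc-i inc-j with mate i Fin.≟ mate j
    ... | yes eq    = common-edge⇒≡ i j eq (mate-on i) (mate-on j)
    ... | no differ = ⊥-elim (nonadjacent (mate∈M i) (mate∈M j) differ (v , inc-i , inc-j))

    vertexAt : Fin n ⊎ Fin n → Vertex
    vertexAt = [ X , Y ]

    vertexAt-incident : ∀ s → Incident (vertexAt s) (mate (reduce s))
    vertexAt-incident (inj₁ i) = joins⇒incident (Path.e-joins i)
    vertexAt-incident (inj₂ i) = joins⇒incident (joins-sym (Path.e-joins i))

    -- A vertex determines its mate edge by nonadjacency, and the two ends of that edge differ. With
    -- `2 * n` vertices, the mates form a perfect matching.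
    vertexAt-injective : Injective _≡_ _≡_ vertexAt
    vertexAt-injective {s} {t} eq =
      go s t eq (mates-share⇒≡ (subst (λ v → Incident v _) eq (vertexAt-incident s)) (vertexAt-incident t))
      where
      go : ∀ s t → vertexAt s ≡ vertexAt t → reduce s ≡ reduce t → s ≡ t
      go (inj₁ i) (inj₁ .i) _  refl = refl
      go (inj₂ i) (inj₂ .i) _  refl = refl
      go (inj₁ i) (inj₂ .i) eq refl = ⊥-elim (joins⇒≢ (Path.e-joins i) eq)
      go (inj₂ i) (inj₁ .i) eq refl = ⊥-elim (joins⇒≢ (Path.e-joins i) (sym eq))

    vertices↔ : (Fin n ⊎ Fin n) ↔ Vertex
    vertices↔ = injective⇒↔ refl vertexAt vertexAt-injective

    edges↔ : (Fin n ⊎ Fin n) ↔ Edge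
    edges↔ = injective⇒↔ size≡2n edgeAt edgeAt-injective

    -- If Z i = Y j, then Y i is one of the two neighbours X j, Z j of Y j, and in the second
    -- case link i lies on the paths of both i and j.
    Z≢Y : ∀ i j → Z i ≢ Y j
    Z≢Y i j Z≡Y with Path.middle-neighbours j (subst (_~ Y i) Z≡Y (~-sym (joins⇒~ (Path.link-joins i))))
    ... | inj₁ Yi≡Xj with () ← vertexAt-injective {inj₂ i} {inj₁ j} Yi≡Xj
    ... | inj₂ Yi≡Zj with refl ← common-edge⇒≡ i j refl (link-on i) (Path.on⁺ j (inj₂ (joins-sym
                            (subst₂ (Joins (link i)) Yi≡Zj Z≡Y (Path.link-joins i))))) =
      joins⇒≢ (Path.link-joins i) (sym Z≡Y)

    Z-is-X : ∀ i → ∃ λ j → Z i ≡ X j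
    Z-is-X i with Inverse.from vertices↔ (Z i) | Inverse.strictlyInverseˡ vertices↔ (Z i)
    ... | inj₁ j | X≡Z = j , sym X≡Z
    ... | inj₂ j | Y≡Z = ⊥-elim (Z≢Y i j (sym Y≡Z))

    next : Fin n → Fin n
    next = proj₁ ∘ Z-is-X

    open SubdividedFunctionalGraph G vertices↔ edges↔ next Path.e-joins
      (λ i → subst (Joins (link i) (Y i)) (proj₂ (Z-is-X i)) (Path.link-joins i))
      using (no-odd-orbit; module Colouring)

    result : (∀ c → ¬ (countContained c paths % 2 ≡ 1)) → TwoVariegated G × TwoVariegated (LineGraph G)
    result even-cycles = Colouring.bothTwoVariegated (proj₁ colouring) (proj₂ colouring) refl size≡2n
      where
      on-cases : ∀ i e → e On XYZPath.vertices (paths i) → Joins e (X i) (Y i) ⊎ Joins e (Y i) (X (next i))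
      on-cases i e on = Sum.map₂ (subst (Joins e (Y i)) (proj₂ (Z-is-X i))) (Path.on⁻ i on)
      colouring : ∃ λ (g : Fin n → Bool) → ∀ i → g (next i) ≡ not (g i)
      colouring = two-colouring next (no-odd-orbit paths mate-on on-cases even-cycles)

corollary1p1 : (n q : ℕ) (B₁ : Graph (2 * n)) → let open Graph B₁ in
    size ≡ q → 2 ∣ q → q / 2 ≡ n →
    (∃[ paths ]
    ((∀ (i j : Fin n) → i ≢ j → EdgeDisjoint (paths i) (paths j)) ×
    (∀ (c : Cycle) → ¬ (countContained c paths % 2 ≡ 1)) ×
    (∃[ M ]
    (∣ M ∣ ≡ n ×
    PairwiseNonadjacent M ×
    (∀ e → e ∈ M → ∃! _≡_ (λ i → e On XYZPath.vertices (paths i))))))) →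
    TwoVariegated B₁ × TwoVariegated (LineGraph B₁)
corollary1p1 n q B₁ size≡q 2∣q q/2≡n (paths , disjoint , even-cycles , M , ∣M∣≡n , nonadjacent , exact) =
  Decomposition.result B₁ paths disjoint M nonadjacent
    (markedEdges B₁ paths M ∣M∣≡n nonadjacent exact) size≡2n even-cycles
  where
  size≡2n : Graph.size B₁ ≡ 2 * n
  -- Evenness of `q` makes the halving exact.
  size≡2n = trans size≡q (trans (sym (m/n*n≡m 2∣q)) (trans (cong (_* 2) q/2≡n) (ℕ.*-comm n 2)))
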